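{- Let $\alpha\in[0,1]$, let $G$ be a simple undirected graph on $n$ vertices, and let $x\in\mathbb{R}^n$ and $\lambda\in\mathbb{R}$ satisfy $B(G)x=\lambda x$. Let $G\cup\{u\}$ be the graph obtained from $G$ by adding a new vertex $u$ with no additional edges. Then $x$ can be extended to an eigenvector $y=[x,0]^T\in\mathbb{R}^{n+1}$ (with the entry $0$ at $u$) of $B(G\cup\{u\})$ corresponding to $\lambda$, that is, $B(G\cup\{u\})y=\lambda y$.
   Context: For a graph $G$, $A(G)$ is the adjacency matrix, $D(G)$ the diagonal degree matrix, $L(G)=D(G)-A(G)$ the Laplacian, and $B(G)=B_\alpha(G)=\alpha A(G)+(1-\alpha)L(G)$. -}

module Defs where

open import Algebra.Bundles using (CommutativeRing)
open import Data.Empty using (⊥)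
open import Data.Bool.Base using (if_then_else_)
open import Data.Fin.Base using (Fin; fromℕ; inject₁)
open import Data.Fin.Properties using (_≟_; inject₁-injective; fromℕ≢inject₁)
open import Data.Fin.Relation.Unary.Top using (view; ‵fromℕ; ‵inject₁)
open import Data.Fin.Subset using (Subset; ∣_∣)
open import Data.Nat.Base as ℕ using (ℕ; suc)
import Data.Nat.Properties as ℕₚ
open import Data.Product.Base using (_×_; _,_; ∃-syntax)
open import Data.Rational.Base as ℚ using (ℚ; 0ℚ; 1ℚ; ½)
import Data.Rational.Properties as ℚₚ
open import Data.Rational.Solver using (module +-*-Solver)
open import Data.Vec.Base using (tabulate)
open import Data.Vec.Functional using (Vector)
open import Level using (0ℓ)
open import Relation.Binary.Core using (Rel)
open import Relation.Binary.Definitions using (Decidable; Irreflexive; Symmetric)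
open import Relation.Binary.PropositionalEquality
  using (_≡_; refl; sym; trans; cong; subst)
open import Relation.Nullary.Decidable using (yes; no; does; map′)

-- The real numbers, as Cauchy sequences of rationals identified when their
-- difference tends to zero.

Cauchy : (ℕ → ℚ) → Set
Cauchy s = ∀ ε → 0ℚ ℚ.< ε →
  ∃[ N ] ∀ m n → N ℕ.≤ m → N ℕ.≤ n → ℚ.∣ s m ℚ.- s n ∣ ℚ.< ε

record ℝ : Set where
  constructor mkℝ
  field
    seq    : ℕ → ℚ
    cauchy : Cauchy seq

open ℝ public

infix 4 _≈_ _≤_

-- A record rather than a function, so that x and y can be inferred from x ≈ y.
record _≈_ (x y : ℝ) : Set where
  constructor mk≈
  field
    difference→0 : ∀ ε → 0ℚ ℚ.< ε →
      ∃[ N ] ∀ n → N ℕ.≤ n → ℚ.∣ seq x n ℚ.- seq y n ∣ ℚ.< ε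

open _≈_ public

_≤_ : ℝ → ℝ → Set
x ≤ y = ∀ ε → 0ℚ ℚ.< ε →
  ∃[ N ] ∀ n → N ℕ.≤ n → seq x n ℚ.< seq y n ℚ.+ ε

private

  -- Double sequences tending to zero: this covers both Cauchy s, with
  -- f m n = s m - s n, and x ≈ y, with f m n = x n - y n.
  Null : (ℕ → ℕ → ℚ) → Set
  Null f = ∀ ε → 0ℚ ℚ.< ε →
    ∃[ N ] ∀ m n → N ℕ.≤ m → N ℕ.≤ n → ℚ.∣ f m n ∣ ℚ.< ε

  Bounded : (ℕ → ℚ) → Set
  Bounded s = ∃[ M ] 0ℚ ℚ.< M × ∃[ N ] ∀ n → N ℕ.≤ n → ℚ.∣ s n ∣ ℚ.≤ M

  abstract

    Null-ext : ∀ {f g} → (∀ m n → f m n ≡ g m n) → Null f → Null g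
    Null-ext eq f→0 ε 0<ε with f→0 ε 0<ε
    ... | N , h = N , λ m n p q →
      subst (λ z → ℚ.∣ z ∣ ℚ.< ε) (eq m n) (h m n p q)

    Null-neg : ∀ {f} → Null f → Null (λ m n → ℚ.- f m n)
    Null-neg {f} f→0 ε 0<ε with f→0 ε 0<ε
    ... | N , h = N , λ m n p q →
      subst (ℚ._< ε) (sym (ℚₚ.∣-p∣≡∣p∣ (f m n))) (h m n p q)

    Null-+ : ∀ {f g} → Null f → Null g → Null (λ m n → f m n ℚ.+ g m n)
    Null-+ {f} {g} f→0 g→0 ε 0<ε
      with f→0 (½ ℚ.* ε) 0<ε/2 | g→0 (½ ℚ.* ε) 0<ε/2
      where
      0<ε/2 : 0ℚ ℚ.< ½ ℚ.* ε
      0<ε/2 = subst (ℚ._< ½ ℚ.* ε) (ℚₚ.*-zeroʳ ½) (ℚₚ.*-monoʳ-<-pos ½ 0<ε)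
    ... | N₁ , h₁ | N₂ , h₂ = N₁ ℕ.⊔ N₂ , λ m n p q →
      ℚₚ.≤-<-trans (ℚₚ.∣p+q∣≤∣p∣+∣q∣ (f m n) (g m n))
        (subst (ℚ.∣ f m n ∣ ℚ.+ ℚ.∣ g m n ∣ ℚ.<_) halves
          (ℚₚ.+-mono-<
            (h₁ m n (ℕₚ.m⊔n≤o⇒m≤o N₁ N₂ p) (ℕₚ.m⊔n≤o⇒m≤o N₁ N₂ q))
            (h₂ m n (ℕₚ.m⊔n≤o⇒n≤o N₁ N₂ p) (ℕₚ.m⊔n≤o⇒n≤o N₁ N₂ q))))
      where
      halves : ½ ℚ.* ε ℚ.+ ½ ℚ.* ε ≡ ε
      halves = trans (sym (ℚₚ.*-distribʳ-+ ε ½ ½)) (ℚₚ.*-identityˡ ε)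

    Null-* : ∀ {f} (b : ℕ → ℕ → ℚ) M N → 0ℚ ℚ.< M →
             (∀ m n → N ℕ.≤ m → N ℕ.≤ n → ℚ.∣ b m n ∣ ℚ.≤ M) →
             Null f → Null (λ m n → b m n ℚ.* f m n)
    Null-* {f} b M N 0<M b≤M f→0 ε 0<ε with f→0 (1/M ℚ.* ε) 0<ε/M
      where
      instance
        M-pos : ℚ.Positive M
        M-pos = ℚ.positive 0<M
        M-nonZero : ℚ.NonZero M
        M-nonZero = ℚₚ.pos⇒nonZero M
      1/M : ℚ
      1/M = ℚ.1/ M
      0<ε/M : 0ℚ ℚ.< 1/M ℚ.* ε
      0<ε/M = subst (ℚ._< 1/M ℚ.* ε) (ℚₚ.*-zeroʳ 1/M)
        (ℚₚ.*-monoʳ-<-pos 1/M {{ℚₚ.1/pos⇒pos M}} 0<ε)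
    ... | N′ , h = N ℕ.⊔ N′ , λ m n p q →
      subst (ℚ._< ε) (sym (ℚₚ.∣p*q∣≡∣p∣*∣q∣ (b m n) (f m n)))
        (ℚₚ.≤-<-trans
          (ℚₚ.*-monoʳ-≤-nonNeg ℚ.∣ f m n ∣ {{ℚ.nonNegative (ℚₚ.0≤∣p∣ (f m n))}}
            (b≤M m n (ℕₚ.m⊔n≤o⇒m≤o N N′ p) (ℕₚ.m⊔n≤o⇒m≤o N N′ q)))
          (subst (M ℚ.* ℚ.∣ f m n ∣ ℚ.<_) M*ε/M≡ε
            (ℚₚ.*-monoʳ-<-pos M
              (h m n (ℕₚ.m⊔n≤o⇒n≤o N N′ p) (ℕₚ.m⊔n≤o⇒n≤o N N′ q)))))
      where
      instance
        M-pos : ℚ.Positive M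
        M-pos = ℚ.positive 0<M
        M-nonZero : ℚ.NonZero M
        M-nonZero = ℚₚ.pos⇒nonZero M
      M*ε/M≡ε : M ℚ.* (ℚ.1/ M ℚ.* ε) ≡ ε
      M*ε/M≡ε = trans (sym (ℚₚ.*-assoc M (ℚ.1/ M) ε))
        (trans (cong (ℚ._* ε) (ℚₚ.*-inverseʳ M)) (ℚₚ.*-identityˡ ε))

    0<1 : 0ℚ ℚ.< 1ℚ
    0<1 = ℚₚ.positive⁻¹ 1ℚ

    bounded : ∀ x → Bounded (seq x)
    bounded (mkℝ s c) with c 1ℚ 0<1
    ... | N , h = 1ℚ ℚ.+ ℚ.∣ s N ∣ , ℚₚ.+-mono-<-≤ 0<1 (ℚₚ.0≤∣p∣ (s N)) , N , λ n p →
      ℚₚ.≤-trans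
        (subst (λ z → ℚ.∣ z ∣ ℚ.≤ ℚ.∣ s n ℚ.- s N ∣ ℚ.+ ℚ.∣ s N ∣) (cancel (s n) (s N))
          (ℚₚ.∣p+q∣≤∣p∣+∣q∣ (s n ℚ.- s N) (s N)))
        (ℚₚ.+-monoˡ-≤ ℚ.∣ s N ∣ (ℚₚ.<⇒≤ (h n N p ℕₚ.≤-refl)))
      where
      cancel : ∀ a b → (a ℚ.- b) ℚ.+ b ≡ a
      cancel = solve 2 (λ a b → (a :- b) :+ b := a) refl
        where open +-*-Solver

    toNull : ∀ {x y} → x ≈ y → Null (λ _ n → seq x n ℚ.- seq y n)
    toNull (mk≈ d) ε 0<ε with d ε 0<ε
    ... | N , h = N , λ _ n _ q → h n q

    fromNull : ∀ {x y} → Null (λ _ n → seq x n ℚ.- seq y n) → x ≈ y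
    fromNull d = mk≈ λ ε 0<ε → let N , h = d ε 0<ε in N , λ n p → h n n p p

    Null-0 : ∀ {f} → (∀ m n → f m n ≡ 0ℚ) → Null f
    Null-0 f≡0 ε 0<ε = 0 , λ m n _ _ → subst (λ z → ℚ.∣ z ∣ ℚ.< ε) (sym (f≡0 m n)) 0<ε

    ≗⇒≈ : ∀ {x y} → (∀ n → seq x n ≡ seq y n) → x ≈ y
    ≗⇒≈ {x} {y} eq = fromNull (Null-0 λ _ n →
      trans (cong (ℚ._- seq y n) (eq n)) (ℚₚ.+-inverseʳ (seq y n)))

    const-cauchy : ∀ q → Cauchy (λ _ → q)
    const-cauchy q = Null-0 λ _ _ → ℚₚ.+-inverseʳ q

    +-cauchy : ∀ x y → Cauchy (λ n → seq x n ℚ.+ seq y n)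
    +-cauchy x y = Null-ext
      (λ m n → regroup (seq x m) (seq x n) (seq y m) (seq y n))
      (Null-+ (cauchy x) (cauchy y))
      where
      regroup : ∀ a b c d → (a ℚ.- b) ℚ.+ (c ℚ.- d) ≡ (a ℚ.+ c) ℚ.- (b ℚ.+ d)
      regroup = solve 4 (λ a b c d → (a :- b) :+ (c :- d) := (a :+ c) :- (b :+ d)) refl
        where open +-*-Solver

    neg-cauchy : ∀ x → Cauchy (λ n → ℚ.- seq x n)
    neg-cauchy x = Null-ext (λ m n → ℚₚ.neg-distrib-+ (seq x m) (ℚ.- seq x n))
      (Null-neg (cauchy x))

    *-regroup : ∀ a b c d → a ℚ.* (c ℚ.- d) ℚ.+ d ℚ.* (a ℚ.- b) ≡ a ℚ.* c ℚ.- b ℚ.* d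
    *-regroup = solve 4
      (λ a b c d → a :* (c :- d) :+ d :* (a :- b) := a :* c :- b :* d) refl
      where open +-*-Solver

    Null-*-* : ∀ {a b c d : ℕ → ℕ → ℚ} {M₁ M₂} N₁ N₂ → 0ℚ ℚ.< M₁ → 0ℚ ℚ.< M₂ →
      (∀ m n → N₁ ℕ.≤ m → N₁ ℕ.≤ n → ℚ.∣ a m n ∣ ℚ.≤ M₁) →
      (∀ m n → N₂ ℕ.≤ m → N₂ ℕ.≤ n → ℚ.∣ d m n ∣ ℚ.≤ M₂) →
      Null (λ m n → a m n ℚ.- b m n) → Null (λ m n → c m n ℚ.- d m n) →
      Null (λ m n → a m n ℚ.* c m n ℚ.- b m n ℚ.* d m n)
    Null-*-* {a} {b} {c} {d} {M₁} {M₂} N₁ N₂ 0<M₁ 0<M₂ h₁ h₂ p q =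
      Null-ext {λ m n → a m n ℚ.* (c m n ℚ.- d m n) ℚ.+ d m n ℚ.* (a m n ℚ.- b m n)}
        (λ m n → *-regroup (a m n) (b m n) (c m n) (d m n))
        (Null-+ {λ m n → a m n ℚ.* (c m n ℚ.- d m n)}
                {λ m n → d m n ℚ.* (a m n ℚ.- b m n)}
          (Null-* {λ m n → c m n ℚ.- d m n} a M₁ N₁ 0<M₁ h₁ q)
          (Null-* {λ m n → a m n ℚ.- b m n} d M₂ N₂ 0<M₂ h₂ p))

    *-cauchy : ∀ x y → Cauchy (λ n → seq x n ℚ.* seq y n)
    *-cauchy x y =
      let _ , 0<M₁ , N₁ , h₁ = bounded x
          _ , 0<M₂ , N₂ , h₂ = bounded y
      in Null-*-* {λ m _ → seq x m} {λ _ n → seq x n} {λ m _ → seq y m} {λ _ n → seq y n}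
           N₁ N₂ 0<M₁ 0<M₂ (λ m _ r _ → h₁ m r) (λ _ n _ r → h₂ n r)
           (cauchy x) (cauchy y)

infixl 6 _+_ _-_
infixl 7 _*_
infix  8 -_

fromℚ : ℚ → ℝ
fromℚ q = mkℝ (λ _ → q) (const-cauchy q)

0ℝ 1ℝ : ℝ
0ℝ = fromℚ 0ℚ
1ℝ = fromℚ 1ℚ

_+_ _*_ : ℝ → ℝ → ℝ
x + y = mkℝ (λ n → seq x n ℚ.+ seq y n) (+-cauchy x y)
x * y = mkℝ (λ n → seq x n ℚ.* seq y n) (*-cauchy x y)

-_ : ℝ → ℝ
- x = mkℝ (λ n → ℚ.- seq x n) (neg-cauchy x)

_-_ : ℝ → ℝ → ℝ
x - y = x + (- y)

private
  abstract

    ≈-refl : ∀ {x} → x ≈ x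
    ≈-refl = ≗⇒≈ λ _ → refl

    ≈-sym : ∀ {x y} → x ≈ y → y ≈ x
    ≈-sym {x} {y} p = fromNull (Null-ext
      (λ _ n → flip-sub (seq x n) (seq y n)) (Null-neg (toNull p)))
      where
      flip-sub : ∀ a b → ℚ.- (a ℚ.- b) ≡ b ℚ.- a
      flip-sub = solve 2 (λ a b → :- (a :- b) := b :- a) refl
        where open +-*-Solver

    ≈-trans : ∀ {x y z} → x ≈ y → y ≈ z → x ≈ z
    ≈-trans {x} {y} {z} p q = fromNull (Null-ext
      (λ _ n → telescope (seq x n) (seq y n) (seq z n))
      (Null-+ (toNull p) (toNull q)))
      where
      telescope : ∀ a b c → (a ℚ.- b) ℚ.+ (b ℚ.- c) ≡ a ℚ.- c
      telescope = solve 3 (λ a b c → (a :- b) :+ (b :- c) := a :- c) refl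
        where open +-*-Solver

    +-cong : ∀ {x y u v} → x ≈ y → u ≈ v → x + u ≈ y + v
    +-cong {x} {y} {u} {v} p q = fromNull (Null-ext
      (λ _ n → regroup (seq x n) (seq y n) (seq u n) (seq v n))
      (Null-+ (toNull p) (toNull q)))
      where
      regroup : ∀ a b c d → (a ℚ.- b) ℚ.+ (c ℚ.- d) ≡ (a ℚ.+ c) ℚ.- (b ℚ.+ d)
      regroup = solve 4 (λ a b c d → (a :- b) :+ (c :- d) := (a :+ c) :- (b :+ d)) refl
        where open +-*-Solver

    neg-cong : ∀ {x y} → x ≈ y → - x ≈ - y
    neg-cong {x} {y} p = fromNull (Null-ext
      (λ _ n → ℚₚ.neg-distrib-+ (seq x n) (ℚ.- seq y n)) (Null-neg (toNull p)))

    *-cong : ∀ {x y u v} → x ≈ y → u ≈ v → x * u ≈ y * v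
    *-cong {x} {y} {u} {v} p q =
      let _ , 0<M₁ , N₁ , h₁ = bounded x
          _ , 0<M₂ , N₂ , h₂ = bounded v
      in fromNull (Null-*-*
           {λ _ n → seq x n} {λ _ n → seq y n} {λ _ n → seq u n} {λ _ n → seq v n}
           N₁ N₂ 0<M₁ 0<M₂ (λ _ n _ r → h₁ n r) (λ _ n _ r → h₂ n r)
           (toNull p) (toNull q))

ℝ-commutativeRing : CommutativeRing 0ℓ 0ℓ
ℝ-commutativeRing = record
  { Carrier = ℝ ; _≈_ = _≈_ ; _+_ = _+_ ; _*_ = _*_ ; -_ = -_ ; 0# = 0ℝ ; 1# = 1ℝ
  ; isCommutativeRing = record
    { isRing = record
      { +-isAbelianGroup = record
        { isGroup = record
          { isMonoid = record
            { isSemigroup = record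
              { isMagma = record
                { isEquivalence = record
                  { refl = ≈-refl ; sym = ≈-sym ; trans = ≈-trans }
                ; ∙-cong = +-cong }
              ; assoc = λ x y z → ≗⇒≈ λ n → ℚₚ.+-assoc (seq x n) (seq y n) (seq z n) }
            ; identity = (λ x → ≗⇒≈ λ n → ℚₚ.+-identityˡ (seq x n))
                       , (λ x → ≗⇒≈ λ n → ℚₚ.+-identityʳ (seq x n)) }
          ; inverse = (λ x → ≗⇒≈ λ n → ℚₚ.+-inverseˡ (seq x n))
                    , (λ x → ≗⇒≈ λ n → ℚₚ.+-inverseʳ (seq x n))
          ; ⁻¹-cong = neg-cong }
        ; comm = λ x y → ≗⇒≈ λ n → ℚₚ.+-comm (seq x n) (seq y n) }
      ; *-cong = *-cong
      ; *-assoc = λ x y z → ≗⇒≈ λ n → ℚₚ.*-assoc (seq x n) (seq y n) (seq z n)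
      ; *-identity = (λ x → ≗⇒≈ λ n → ℚₚ.*-identityˡ (seq x n))
                   , (λ x → ≗⇒≈ λ n → ℚₚ.*-identityʳ (seq x n))
      ; distrib = (λ x y z → ≗⇒≈ λ n → ℚₚ.*-distribˡ-+ (seq x n) (seq y n) (seq z n))
                , (λ x y z → ≗⇒≈ λ n → ℚₚ.*-distribʳ-+ (seq x n) (seq y n) (seq z n))
      }
    ; *-comm = λ x y → ≗⇒≈ λ n → ℚₚ.*-comm (seq x n) (seq y n)
    }
  }

open import Algebra.Definitions.RawMonoid
  (CommutativeRing.+-rawMonoid ℝ-commutativeRing) using (sum) renaming (_×_ to _×ℝ_)

fromℕᴿ : ℕ → ℝ
fromℕᴿ k = k ×ℝ 1ℝ

Matrix : ℕ → Set
Matrix n = Fin n → Fin n → ℝ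

infixl 6 _+ᴹ_ _-ᴹ_
infixr 7 _·ᴹ_ _·ᵛ_ _*ᵛ_
infix  4 _≈ᵛ_

_+ᴹ_ _-ᴹ_ : ∀ {n} → Matrix n → Matrix n → Matrix n
(P +ᴹ Q) i j = P i j + Q i j
(P -ᴹ Q) i j = P i j - Q i j

_·ᴹ_ : ∀ {n} → ℝ → Matrix n → Matrix n
(c ·ᴹ P) i j = c * P i j

_*ᵛ_ : ∀ {n} → Matrix n → Vector ℝ n → Vector ℝ n
(P *ᵛ x) i = sum λ j → P i j * x j

_·ᵛ_ : ∀ {n} → ℝ → Vector ℝ n → Vector ℝ n
(c ·ᵛ x) i = c * x i

_≈ᵛ_ : ∀ {n} → Vector ℝ n → Vector ℝ n → Set
x ≈ᵛ y = ∀ i → x i ≈ y i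

record Graph (n : ℕ) : Set₁ where
  infix 4 _~_ _~?_
  field
    _~_    : Rel (Fin n) 0ℓ
    symm   : Symmetric _~_
    irrefl : Irreflexive _≡_ _~_
    _~?_   : Decidable _~_

  neighbours : Fin n → Subset n
  neighbours i = tabulate λ j → does (i ~? j)

  degree : Fin n → ℕ
  degree i = ∣ neighbours i ∣

module _ {n : ℕ} (G : Graph n) where
  open Graph G

  A : Matrix n
  A i j = if does (i ~? j) then 1ℝ else 0ℝ

  D : Matrix n
  D i j = if does (i ≟ j) then fromℕᴿ (degree i) else 0ℝ

  L : Matrix n
  L = D -ᴹ A

B : ∀ {n} → ℝ → Graph n → Matrix n
B α G = α ·ᴹ A G +ᴹ (1ℝ - α) ·ᴹ L G

-- In G ∪u the vertex inject₁ i is the vertex i of G, and u is the last vertex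
-- fromℕ n. The only edges are those of G.
module _ {n : ℕ} (G : Graph n) where
  open Graph G

  data Edge∪u : Rel (Fin (suc n)) 0ℓ where
    old : ∀ {i j} → i ~ j → Edge∪u (inject₁ i) (inject₁ j)

  private

    old⁻¹ : ∀ {k l} → Edge∪u k l →
            ∃[ i ] ∃[ j ] k ≡ inject₁ i × l ≡ inject₁ j × i ~ j
    old⁻¹ (old e) = _ , _ , refl , refl , e

    edge? : Decidable Edge∪u
    edge? k l with view k | view l
    ... | ‵fromℕ     | _          = no λ e →
      let _ , _ , eq , _ = old⁻¹ e in fromℕ≢inject₁ eq
    ... | ‵inject₁ _ | ‵fromℕ     = no λ e →
      let _ , _ , _ , eq , _ = old⁻¹ e in fromℕ≢inject₁ eq
    ... | ‵inject₁ i | ‵inject₁ j = map′ old restrict (i ~? j)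
      where
      restrict : Edge∪u (inject₁ i) (inject₁ j) → i ~ j
      restrict e with old⁻¹ e
      ... | _ , _ , p , q , e′
        rewrite inject₁-injective p | inject₁-injective q = e′

    loopless : ∀ {k l} → k ≡ l → Edge∪u k l → ⊥
    loopless k≡l e with old⁻¹ e
    ... | _ , _ , p , q , e′ =
      irrefl (inject₁-injective (trans (sym p) (trans k≡l q))) e′

  _∪u : Graph (suc n)
  _∪u = record
    { _~_    = Edge∪u
    ; symm   = λ { (old e) → old (symm e) }
    ; irrefl = loopless
    ; _~?_   = edge?
    }

-- The column vector [ x , a ]ᵀ, with a as the entry at the last index.
[_,_]ᵀ : ∀ {n} → Vector ℝ n → ℝ → Vector ℝ (suc n)
[ x , a ]ᵀ k with view k
... | ‵fromℕ     = a
... | ‵inject₁ i = x i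

{-# OPTIONS --safe #-}
module Submission where

-- u is isolated, so B(G ∪ u) restricts to B(G) on the old vertices and its row at u
-- vanishes off the diagonal. The entries in the column of u, the diagonal one
-- included, are multiplied by the entry 0 of y.

open import Defs
open import Data.Nat.Base using (ℕ; zero; suc)
open import Data.Vec.Functional using (Vector)
open import Algebra.Bundles using (CommutativeRing)
open import Data.Bool.Base using (Bool; true; false; if_then_else_)
open import Data.Fin.Base using (Fin; zero; suc; fromℕ; inject₁)
open import Data.Fin.Properties using (_≟_; inject₁-injective; fromℕ≢inject₁)
open import Data.Fin.Relation.Unary.Top
  using (view; ‵fromℕ; ‵inject₁; view-fromℕ; view-inject₁)
open import Data.Fin.Subset using (∣_∣)
open import Data.Vec.Base using (tabulate)
open import Data.Vec.Properties using (tabulate-cong)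
open import Function.Base using (_∘_)
open import Function.Bundles using (mk⇔)
open import Relation.Binary.PropositionalEquality
  using (_≡_; refl; sym; trans; cong; cong₂)
open import Relation.Nullary.Decidable using (does; dec-false; does-⇔)
open import Relation.Nullary.Negation.Core using (¬_)

open CommutativeRing ℝ-commutativeRing
  using (setoid; +-monoid; +-cong; *-cong; zeroˡ; zeroʳ; +-identityʳ; -‿inverseʳ)
  renaming (refl to ≈-refl)
open import Algebra.Properties.Monoid.Sum +-monoid
  using (sum; sum-cong-≋; sum-cong-≗; sum-init-last; sum-replicate-zero)
open import Relation.Binary.Reasoning.Setoid setoid

-- The motive `P` is a variable here, so matching on `view k` does not disturb the calls of `view`
-- that `[_,_]ᵀ` puts into a concrete goal.
top-or-inject₁ : ∀ {n} {P : Fin (suc n) → Set} →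
                 P (fromℕ n) → (∀ i → P (inject₁ i)) → ∀ k → P k
top-or-inject₁ top inj k with view k
... | ‵fromℕ     = top
... | ‵inject₁ i = inj i

-- `view (inject₁ i)` is stuck for a variable `i`; rewriting with `view-inject₁` lets the definition
-- of `[_,_]ᵀ` compute.
[,]ᵀ-inject₁ : ∀ {n} (x : Vector ℝ n) a i → [ x , a ]ᵀ (inject₁ i) ≡ x i
[,]ᵀ-inject₁ x a i rewrite view-inject₁ i = refl

[,]ᵀ-fromℕ : ∀ {n} (x : Vector ℝ n) a → [ x , a ]ᵀ (fromℕ n) ≡ a
[,]ᵀ-fromℕ {n} x a rewrite view-fromℕ n = refl

sum-0ℝ : ∀ {n} {t : Vector ℝ n} → (∀ i → t i ≈ 0ℝ) → sum t ≈ 0ℝ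
sum-0ℝ {n} {t} t≈0 = begin
  sum t              ≈⟨ sum-cong-≋ t≈0 ⟩
  sum {n} (λ _ → 0ℝ) ≈⟨ sum-replicate-zero n ⟩
  0ℝ                 ∎

-- `tabulate` peels entries off the front while the dropped one is at the back, hence the induction:
-- the front entries match one by one until only the `false` remains.
∣tabulate∣-last-false : ∀ {n} (f : Fin (suc n) → Bool) → f (fromℕ n) ≡ false →
                        ∣ tabulate f ∣ ≡ ∣ tabulate (f ∘ inject₁) ∣
∣tabulate∣-last-false {zero} f eq rewrite eq = refl
∣tabulate∣-last-false {suc n} f eq with f zero
... | true  = cong suc (∣tabulate∣-last-false (f ∘ suc) eq)
... | false = ∣tabulate∣-last-false (f ∘ suc) eq

-- The last summand carries the factor `0ℝ`. With `P` and `k` arbitrary, this serves the row of u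
-- and the old rows alike.
*ᵛ-[,0]ᵀ : ∀ {n} (P : Matrix (suc n)) (x : Vector ℝ n) k →
           (P *ᵛ [ x , 0ℝ ]ᵀ) k ≈ sum (λ j → P k (inject₁ j) * x j)
*ᵛ-[,0]ᵀ {n} P x k = begin
  (P *ᵛ [ x , 0ℝ ]ᵀ) k
    ≈⟨ sum-init-last (λ l → P k l * [ x , 0ℝ ]ᵀ l) ⟩
  sum (λ j → P k (inject₁ j) * [ x , 0ℝ ]ᵀ (inject₁ j))
    + P k (fromℕ n) * [ x , 0ℝ ]ᵀ (fromℕ n)
    ≡⟨ cong₂ _+_ (sum-cong-≗ λ j → cong (P k (inject₁ j) *_) ([,]ᵀ-inject₁ x 0ℝ j))
                 (cong (P k (fromℕ n) *_) ([,]ᵀ-fromℕ x 0ℝ)) ⟩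
  sum (λ j → P k (inject₁ j) * x j) + P k (fromℕ n) * 0ℝ
    ≈⟨ +-cong ≈-refl (zeroʳ (P k (fromℕ n))) ⟩
  sum (λ j → P k (inject₁ j) * x j) + 0ℝ
    ≈⟨ +-identityʳ _ ⟩
  sum (λ j → P k (inject₁ j) * x j) ∎

module _ {n : ℕ} (G : Graph n) where
  open Graph G
  open Graph (G ∪u) using () renaming (_~?_ to _~?′_; degree to degree′)

  -- The indices are variables tied by equations because `inject₁ i` is not a constructor form, so
  -- matching on `old` at such indices would not unify. Injectivity then identifies the endpoints.
  old⁻¹ : ∀ {k l i j} → k ≡ inject₁ i → l ≡ inject₁ j → Edge∪u G k l → i ~ j
  old⁻¹ p q (old e)
    with refl ← inject₁-injective p | refl ← inject₁-injective q = e

  fromℕ-isolatedˡ : ∀ {k l} → k ≡ fromℕ n → ¬ Edge∪u G k l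
  fromℕ-isolatedˡ p (old _) = fromℕ≢inject₁ (sym p)

  fromℕ-isolatedʳ : ∀ {k l} → l ≡ fromℕ n → ¬ Edge∪u G k l
  fromℕ-isolatedʳ p (old _) = fromℕ≢inject₁ (sym p)

  -- Decisions of equivalent propositions have the same boolean, so the decision procedure of `G ∪u`
  -- need not be unfolded.
  does-~?-inject₁ : ∀ i j → does (inject₁ i ~?′ inject₁ j) ≡ does (i ~? j)
  does-~?-inject₁ i j =
    does-⇔ (mk⇔ (old⁻¹ refl refl) old) (inject₁ i ~?′ inject₁ j) (i ~? j)

  -- The only new candidate for a neighbour is u, and it is isolated.
  degree-inject₁ : ∀ i → degree′ (inject₁ i) ≡ degree i
  degree-inject₁ i = trans
    (∣tabulate∣-last-false (λ l → does (inject₁ i ~?′ l))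
      (dec-false (inject₁ i ~?′ fromℕ n) (fromℕ-isolatedʳ refl)))
    (cong ∣_∣ (tabulate-cong (does-~?-inject₁ i)))

  A-inject₁ : ∀ i j → A (G ∪u) (inject₁ i) (inject₁ j) ≡ A G i j
  A-inject₁ i j = cong (if_then 1ℝ else 0ℝ) (does-~?-inject₁ i j)

  D-inject₁ : ∀ i j → D (G ∪u) (inject₁ i) (inject₁ j) ≡ D G i j
  D-inject₁ i j = cong₂ (λ b d → if b then fromℕᴿ d else 0ℝ)
    (does-⇔ (mk⇔ inject₁-injective (cong inject₁)) (inject₁ i ≟ inject₁ j) (i ≟ j))
    (degree-inject₁ i)

  B-inject₁ : ∀ α i j → B α (G ∪u) (inject₁ i) (inject₁ j) ≡ B α G i j
  -- An entry of `B` unfolds to this expression in the entries of `A` and `D` at the same position.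
  B-inject₁ α i j = cong₂ (λ a d → α * a + (1ℝ - α) * (d - a))
    (A-inject₁ i j) (D-inject₁ i j)

  A-fromℕ : ∀ l → A (G ∪u) (fromℕ n) l ≡ 0ℝ
  A-fromℕ l = cong (if_then 1ℝ else 0ℝ)
    (dec-false (fromℕ n ~?′ l) (fromℕ-isolatedˡ refl))

  D-fromℕ-inject₁ : ∀ j → D (G ∪u) (fromℕ n) (inject₁ j) ≡ 0ℝ
  D-fromℕ-inject₁ j = cong (if_then fromℕᴿ (degree′ (fromℕ n)) else 0ℝ)
    (dec-false (fromℕ n ≟ inject₁ j) fromℕ≢inject₁)

  -- The old columns suffice: they are the ones that `*ᵛ-[,0]ᵀ` keeps in the sum.
  B-fromℕ-inject₁ : ∀ α j → B α (G ∪u) (fromℕ n) (inject₁ j) ≈ 0ℝ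
  B-fromℕ-inject₁ α j = begin
    B α (G ∪u) (fromℕ n) (inject₁ j)
      ≡⟨ cong₂ (λ a d → α * a + (1ℝ - α) * (d - a))
           (A-fromℕ (inject₁ j)) (D-fromℕ-inject₁ j) ⟩
    α * 0ℝ + (1ℝ - α) * (0ℝ - 0ℝ)
      ≈⟨ +-cong (zeroʳ α) (*-cong ≈-refl (-‿inverseʳ 0ℝ)) ⟩
    0ℝ + (1ℝ - α) * 0ℝ
      ≈⟨ +-cong ≈-refl (zeroʳ (1ℝ - α)) ⟩
    0ℝ + 0ℝ
      ≈⟨ +-identityʳ 0ℝ ⟩
    0ℝ ∎

theorem3p8 : (α : ℝ) → 0ℝ ≤ α → α ≤ 1ℝ →
    (n : ℕ) (G : Graph n) (x : Vector ℝ n) (μ : ℝ) →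
    B α G *ᵛ x ≈ᵛ μ ·ᵛ x →
    B α (G ∪u) *ᵛ [ x , 0ℝ ]ᵀ ≈ᵛ μ ·ᵛ [ x , 0ℝ ]ᵀ
theorem3p8 α _ _ n G x μ Bx≈μx = top-or-inject₁ {P = λ k →
  (B α (G ∪u) *ᵛ [ x , 0ℝ ]ᵀ) k ≈ (μ ·ᵛ [ x , 0ℝ ]ᵀ) k} at-u at-old
  where
  at-u : (B α (G ∪u) *ᵛ [ x , 0ℝ ]ᵀ) (fromℕ n) ≈ μ * [ x , 0ℝ ]ᵀ (fromℕ n)
  at-u = begin
    (B α (G ∪u) *ᵛ [ x , 0ℝ ]ᵀ) (fromℕ n)
      ≈⟨ *ᵛ-[,0]ᵀ (B α (G ∪u)) x (fromℕ n) ⟩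
    sum (λ j → B α (G ∪u) (fromℕ n) (inject₁ j) * x j)
      ≈⟨ sum-cong-≋ (λ j → *-cong (B-fromℕ-inject₁ G α j) ≈-refl) ⟩
    sum (λ j → 0ℝ * x j)
      ≈⟨ sum-0ℝ (λ j → zeroˡ (x j)) ⟩
    0ℝ
      ≈⟨ zeroʳ μ ⟨
    μ * 0ℝ
      ≡⟨ cong (μ *_) ([,]ᵀ-fromℕ x 0ℝ) ⟨
    μ * [ x , 0ℝ ]ᵀ (fromℕ n) ∎

  at-old : ∀ i → (B α (G ∪u) *ᵛ [ x , 0ℝ ]ᵀ) (inject₁ i) ≈ μ * [ x , 0ℝ ]ᵀ (inject₁ i)
  at-old i = begin
    (B α (G ∪u) *ᵛ [ x , 0ℝ ]ᵀ) (inject₁ i)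
      ≈⟨ *ᵛ-[,0]ᵀ (B α (G ∪u)) x (inject₁ i) ⟩
    sum (λ j → B α (G ∪u) (inject₁ i) (inject₁ j) * x j)
      -- With the entries of `B α G` in place, the sum is by definition row `i` of `B α G *ᵛ x`.
      ≡⟨ sum-cong-≗ (λ j → cong (_* x j) (B-inject₁ G α i j)) ⟩
    (B α G *ᵛ x) i
      ≈⟨ Bx≈μx i ⟩
    μ * x i
      ≡⟨ cong (μ *_) ([,]ᵀ-inject₁ x 0ℝ i) ⟨
    μ * [ x , 0ℝ ]ᵀ (inject₁ i) ∎
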